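{- Let $G$ be a graph with $n$ vertices. If $\mathrm{Deg}\,H(G,x)\ge n$, then $G$ contains a triangle (i.e. its girth is $3$). Furthermore, if $G$ is triangle-free and $\mathrm{Deg}\,H(G,x)=n-1$, then $G$ is connected and has diameter at most $3$.
   Context: All graphs are finite, simple and have no isolated vertices; $d_u$ is the degree of $u$. The harmonic polynomial is $H(G,x)=\sum_{uv\in E(G)}x^{d_u+d_v-1}$, and $\mathrm{Deg}\,p(x)$ denotes the degree of a polynomial $p$. The girth is the minimum length of a cycle. -}

module Defs where

open import Data.Fin using (Fin) renaming (_<_ to _<ᶠ_)
open import Data.Fin.Properties using () renaming (_<?_ to _<ᶠ?_)
open import Data.Integer using (ℤ; 0ℤ; 1ℤ) renaming (_+_ to _+ℤ_)
open import Data.List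
  using (List; []; _∷_; _++_; _∷ʳ_; length; map; filter; foldr; replicate; allFin; cartesianProduct)
open import Data.List.Relation.Unary.Linked using (Linked)
open import Data.List.Relation.Unary.Unique.Propositional using (Unique)
open import Data.Nat using (ℕ; zero; suc; _+_; _∸_; _≤_; _<_)
open import Data.Product using (∃-syntax; _×_; _,_; proj₁; proj₂)
open import Relation.Binary using (Rel; Decidable; Symmetric; Irreflexive)
open import Relation.Binary.PropositionalEquality using (_≡_; _≢_)
open import Relation.Nullary using (¬_)
open import Relation.Nullary.Decidable using (_×-dec_)
open import Level using (0ℓ)

-- Polynomials in ℤ[x] as coefficient lists, constant term first. Trailing
-- zeros are allowed, so the degree is read off the coefficients rather than
-- the length of the list.

Poly : Set
Poly = List ℤ

coeff : Poly → ℕ → ℤ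
coeff []      _       = 0ℤ
coeff (a ∷ p) zero    = a
coeff (a ∷ p) (suc k) = coeff p k

infixl 6 _+ₚ_

_+ₚ_ : Poly → Poly → Poly
[]      +ₚ q       = q
(a ∷ p) +ₚ []      = a ∷ p
(a ∷ p) +ₚ (b ∷ q) = (a +ℤ b) ∷ (p +ₚ q)

x^_ : ℕ → Poly
x^ k = replicate k 0ℤ ++ (1ℤ ∷ [])

sumₚ : List Poly → Poly
sumₚ = foldr _+ₚ_ []

-- A relation rather than a function because the zero polynomial has no degree.
HasDeg : Poly → ℕ → Set
HasDeg p d = coeff p d ≢ 0ℤ × (∀ k → d < k → coeff p k ≡ 0ℤ)

record Graph (n : ℕ) : Set₁ where
  infix 4 _~_ _~?_
  field
    _~_    : Rel (Fin n) 0ℓ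
    _~?_   : Decidable _~_
    sym    : Symmetric _~_
    irrefl : Irreflexive _≡_ _~_

IsMinimum : (ℕ → Set) → ℕ → Set
IsMinimum P m = P m × (∀ k → P k → m ≤ k)

module _ {n : ℕ} (G : Graph n) where
  open Graph G

  NoIsolatedVertices : Set
  NoIsolatedVertices = ∀ u → ∃[ v ] u ~ v

  deg : Fin n → ℕ
  deg u = length (filter (u ~?_) (allFin n))

  -- Each edge {u , v} is listed once, as the pair with u < v.
  edges : List (Fin n × Fin n)
  edges = filter (λ e → (proj₁ e <ᶠ? proj₂ e) ×-dec (proj₁ e ~? proj₂ e))
                 (cartesianProduct (allFin n) (allFin n))

  -- The truncated subtraction is exact: endpoints of an edge have degree ≥ 1.
  harmonicPoly : Poly
  harmonicPoly = sumₚ (map (λ (u , v) → x^ (deg u + deg v ∸ 1)) edges)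

  HasTriangle : Set
  HasTriangle = ∃[ u ] ∃[ v ] ∃[ w ] (u ~ v × v ~ w × w ~ u)

  TriangleFree : Set
  TriangleFree = ¬ HasTriangle

  -- The vertices of a cycle in cyclic order; the final ∷ʳ v closes it up.
  data IsCycle : List (Fin n) → Set where
    cycle : ∀ {v vs} → 3 ≤ length (v ∷ vs) → Unique (v ∷ vs) →
            Linked _~_ (v ∷ vs ∷ʳ v) → IsCycle (v ∷ vs)

  HasCycleOfLength : ℕ → Set
  HasCycleOfLength k = ∃[ vs ] (IsCycle vs × length vs ≡ k)

  HasGirth : ℕ → Set
  HasGirth = IsMinimum HasCycleOfLength

  data Walk : ℕ → Fin n → Fin n → Set where
    nil  : ∀ {u} → Walk 0 u u
    cons : ∀ {k u v w} → u ~ v → Walk k v w → Walk (suc k) u w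

  Connected : Set
  Connected = ∀ u v → ∃[ k ] Walk k u v

  HasDistance : Fin n → Fin n → ℕ → Set
  HasDistance u v = IsMinimum (λ k → Walk k u v)

  -- D is the maximum of the distances, all of which are finite.
  HasDiameter : ℕ → Set
  HasDiameter D = (∀ u v → ∃[ d ] (HasDistance u v d × d ≤ D))
                × (∃[ u ] ∃[ v ] HasDistance u v D)

{-# OPTIONS --safe #-}

-- A monomial of degree d in H(G,x) comes from an edge uv with
-- d_u + d_v = d + 1. If d ≥ n, the neighbourhoods N(u) and N(v) have more than n elements
-- in total, so they meet, and uv lies in a triangle. If G is triangle-free,
-- N(u) and N(v) are disjoint; when d = n − 1 they therefore cover all vertices, and any
-- two vertices are joined by a walk of length at most 3 through u, v or both.
module Submission where

open import Defs
open import Data.Nat using (ℕ; _∸_; _≤_; _≥_)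
open import Data.Product using (_×_; ∃-syntax)

open import Data.Empty using (⊥-elim)
open import Data.Fin using (Fin)
import Data.Fin.Properties as Fin
open import Data.Integer using (0ℤ) renaming (_+_ to _+ℤ_; _≟_ to _≟ℤ_)
import Data.Integer.Properties as ℤ
open import Data.List using (List; []; _∷_; length; filter; allFin; cartesianProduct)
open import Data.List.Membership.Propositional using (_∈_; find; lose)
open import Data.List.Membership.Propositional.Properties
  using (∈-filter⁻; ∈-filter⁺; ∈-allFin; ∈-cartesianProduct⁺; ∈-length)
open import Data.List.Properties using (length-filter; length-tabulate; filter-notAll; filter-none)
import Data.List.Relation.Unary.All as All
open import Data.List.Relation.Unary.All using ([]; _∷_)
open import Data.List.Relation.Unary.AllPairs using ([]; _∷_)
open import Data.List.Relation.Unary.Any using (Any; here; there)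
import Data.List.Relation.Unary.Any.Properties as Any
open import Data.List.Relation.Unary.Linked using ([-]; _∷_)
open import Data.Nat using (zero; suc; _+_; _<_; z≤n; s≤s)
open import Data.Nat.Properties
  using (+-suc; +-identityʳ; ≤-refl; ≤-reflexive; ≤-trans; <-irrefl; <-≤-trans; m≤n+m∸n;
         ≤-totalOrder)
open import Data.List.Extrema ≤-totalOrder using (argmax; f[xs]≤f[argmax])
open import Data.Product using (_,_; proj₁; proj₂; uncurry)
open import Data.Sum using (_⊎_; inj₁; inj₂)
open import Function using (_∘_; id)
open import Level using (Level)
open import Relation.Binary.PropositionalEquality
  using (_≡_; _≢_; refl; sym; trans; cong; cong₂; subst; module ≡-Reasoning)
open import Relation.Nullary using (¬_; Dec; yes; no)
open import Relation.Nullary.Decidable using (map′; _×-dec_; decidable-stable)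
open import Relation.Unary using (Pred; Decidable)
open import Relation.Unary.Properties using (_∪?_; _∩?_)

private variable
  a p q : Level
  A : Set a

coeff-+ₚ : ∀ f g k → coeff (f +ₚ g) k ≡ coeff f k +ℤ coeff g k
coeff-+ₚ []      g       k       = sym (ℤ.+-identityˡ (coeff g k))
coeff-+ₚ (b ∷ f) []      k       = sym (ℤ.+-identityʳ (coeff (b ∷ f) k))
coeff-+ₚ (b ∷ f) (c ∷ g) zero    = refl
coeff-+ₚ (b ∷ f) (c ∷ g) (suc k) = coeff-+ₚ f g k

coeff-x^≢0 : ∀ m k → coeff (x^ m) k ≢ 0ℤ → m ≡ k
coeff-x^≢0 zero    zero    _  = refl
coeff-x^≢0 zero    (suc k) ≢0 = ⊥-elim (≢0 refl)
coeff-x^≢0 (suc m) zero    ≢0 = ⊥-elim (≢0 refl)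
coeff-x^≢0 (suc m) (suc k) ≢0 = cong suc (coeff-x^≢0 m k ≢0)

-- If coefficient `k` vanished in every summand, it would vanish in the sum. Deciding equality with
-- `0ℤ` at each summand turns this into a search, which later yields an actual edge.
coeff-sumₚ≢0 : ∀ fs k → coeff (sumₚ fs) k ≢ 0ℤ → Any (λ f → coeff f k ≢ 0ℤ) fs
coeff-sumₚ≢0 []       k ≢0 = ⊥-elim (≢0 refl)
coeff-sumₚ≢0 (f ∷ fs) k ≢0 with coeff f k ≟ℤ 0ℤ
... | no  f≢0 = here f≢0
... | yes f≡0 = there (coeff-sumₚ≢0 fs k λ fs≡0 →
  ≢0 (trans (coeff-+ₚ f (sumₚ fs) k) (cong₂ _+ℤ_ f≡0 fs≡0)))

module _ {P : Pred A p} {Q : Pred A q} (P? : Decidable P) (Q? : Decidable Q) where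

  -- Inclusion-exclusion, stated additively so that no truncated subtraction enters.
  length-filter-∪-∩ : ∀ xs →
    length (filter P? xs) + length (filter Q? xs) ≡
    length (filter (P? ∪? Q?) xs) + length (filter (P? ∩? Q?) xs)
  length-filter-∪-∩ [] = refl
  length-filter-∪-∩ (x ∷ xs) with P? x | Q? x
  ... | yes _ | yes _ = cong suc (trans (+-suc _ _)
                          (trans (cong suc (length-filter-∪-∩ xs)) (sym (+-suc _ _))))
  ... | yes _ | no  _ = cong suc (length-filter-∪-∩ xs)
  ... | no  _ | yes _ = trans (+-suc _ _) (cong suc (length-filter-∪-∩ xs))
  ... | no  _ | no  _ = length-filter-∪-∩ xs

  length-filter-∪ : ∀ xs → filter (P? ∩? Q?) xs ≡ [] →
    length (filter P? xs) + length (filter Q? xs) ≡ length (filter (P? ∪? Q?) xs)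
  length-filter-∪ xs ∩≡[] = begin
    length (filter P? xs) + length (filter Q? xs)
      ≡⟨ length-filter-∪-∩ xs ⟩
    length (filter (P? ∪? Q?) xs) + length (filter (P? ∩? Q?) xs)
      ≡⟨ cong (λ ys → length (filter (P? ∪? Q?) xs) + length ys) ∩≡[] ⟩
    length (filter (P? ∪? Q?) xs) + 0
      ≡⟨ +-identityʳ _ ⟩
    length (filter (P? ∪? Q?) xs) ∎
    where open ≡-Reasoning

  -- Pigeonhole: were the filter by both predicates empty, the two lengths would add up to that of
  -- the union, which is at most `length xs`. Otherwise its head is the witness.
  filters-overlap : ∀ xs → length xs < length (filter P? xs) + length (filter Q? xs) →
                    ∃[ x ] (P x × Q x)
  filters-overlap xs large with filter (P? ∩? Q?) xs in eq
  ... | []    = ⊥-elim (<-irrefl refl (<-≤-trans large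
                  (≤-trans (≤-reflexive (length-filter-∪ xs eq)) (length-filter (P? ∪? Q?) xs))))
  ... | x ∷ _ = x , proj₂ (∈-filter⁻ (P? ∩? Q?) {xs = xs} (subst (x ∈_) (sym eq) (here refl)))

  -- The equality case of the pigeonhole: by disjointness the union has the full combined length,
  -- but a member of `xs` satisfying neither predicate would make the union strictly shorter than
  -- `xs`.
  disjoint-filters-cover : ∀ xs → (∀ x → ¬ (P x × Q x)) →
    length xs ≤ length (filter P? xs) + length (filter Q? xs) →
    All.All (λ x → P x ⊎ Q x) xs
  disjoint-filters-cover xs disjoint large = All.tabulate λ {x} x∈xs →
    decidable-stable ((P? ∪? Q?) x) λ ¬PQx → <-irrefl refl
      (<-≤-trans (filter-notAll (P? ∪? Q?) xs (lose x∈xs ¬PQx))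
        (≤-trans large (≤-reflexive (length-filter-∪ xs
          (filter-none (P? ∩? Q?) (All.universal disjoint xs))))))

-- Recursion on the witness, shifting the predicate down by one. The bound `m ≤ k` lets a distance
-- inherit the length bound of any given walk.
minimum-exists : ∀ {P : ℕ → Set} → (∀ k → Dec (P k)) → ∀ k → P k → ∃[ m ] (IsMinimum P m × m ≤ k)
minimum-exists P? zero Pk = zero , (Pk , λ _ _ → z≤n) , z≤n
minimum-exists {P} P? (suc k) Pk with P? zero
... | yes P0 = zero , (P0 , λ _ _ → z≤n) , z≤n
... | no ¬P0 with minimum-exists (P? ∘ suc) k Pk
...   | m , (Pm , least) , m≤k = suc m , (Pm , least′) , s≤s m≤k
  where
  least′ : ∀ j → P j → suc m ≤ j
  least′ zero    Pj = ⊥-elim (¬P0 Pj)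
  least′ (suc j) Pj = s≤s (least j Pj)

module _ {n : ℕ} (G : Graph n) where
  open Graph G renaming (sym to ~-sym)

  ~⇒≢ : ∀ {u v} → u ~ v → u ≢ v
  ~⇒≢ u~v u≡v = irrefl u≡v u~v

  ~⇒deg>0 : ∀ {u v} → u ~ v → 0 < deg G u
  ~⇒deg>0 {u} {v} u~v = ∈-length (∈-filter⁺ (u ~?_) (∈-allFin v) u~v)

  coeff-harmonicPoly≢0 : ∀ d → coeff (harmonicPoly G) d ≢ 0ℤ →
    ∃[ u ] ∃[ v ] (u ~ v × deg G u + deg G v ≡ suc d)
  coeff-harmonicPoly≢0 d ≢0
    with (u , v) , uv∈edges , cuv≢0 ← find (Any.map⁻ {f = λ (u , v) → x^ (deg G u + deg G v ∸ 1)} {xs = edges G} (coeff-sumₚ≢0 _ d ≢0))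
    with _ , _ , u~v ← ∈-filter⁻ _ {xs = cartesianProduct (allFin n) (allFin n)} uv∈edges
    = u , v , u~v , degree-sum (~⇒deg>0 u~v) (coeff-x^≢0 _ d cuv≢0)
    where
    -- Positivity of the first degree makes `∸ 1` exact, so it can be undone.
    degree-sum : ∀ {i j} → 0 < i → i + j ∸ 1 ≡ d → i + j ≡ suc d
    degree-sum {suc i} _ eq = cong suc eq

  triangle⇒cycle : HasTriangle G → HasCycleOfLength G 3
  triangle⇒cycle (u , v , w , u~v , v~w , w~u) =
    u ∷ v ∷ w ∷ [] ,
    cycle ≤-refl
      ((~⇒≢ u~v ∷ ~⇒≢ w~u ∘ sym ∷ []) ∷ (~⇒≢ v~w ∷ []) ∷ [] ∷ [])
      (u~v ∷ v~w ∷ w~u ∷ [-]) ,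
    refl

  triangle⇒girth3 : HasTriangle G → HasGirth G 3
  -- Minimality is already stored in `cycle`, whose first argument bounds the length below by 3.
  triangle⇒girth3 t = triangle⇒cycle t , λ { _ (_ , cycle 3≤ _ _ , refl) → 3≤ }

  large-degree-sum⇒triangle : ∀ {u v} → u ~ v → n < deg G u + deg G v → HasTriangle G
  large-degree-sum⇒triangle {u} {v} u~v large
    with w , u~w , v~w ← filters-overlap (u ~?_) (v ~?_) (allFin n)
           (subst (_< deg G u + deg G v) (sym (length-tabulate id)) large)
    = u , v , w , u~v , v~w , ~-sym u~w

  neighbourhoods-cover : TriangleFree G → ∀ {u v} → u ~ v → n ≤ deg G u + deg G v →
                         ∀ w → u ~ w ⊎ v ~ w
  neighbourhoods-cover free {u} {v} u~v large w =
    All.lookup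
      (disjoint-filters-cover (u ~?_) (v ~?_) (allFin n)
        (λ x (u~x , v~x) → free (u , v , x , u~v , v~x , ~-sym u~x))
        (subst (_≤ deg G u + deg G v) (sym (length-tabulate id)) large))
      (∈-allFin w)

  -- A first step has only finitely many candidates. Decidability is what allows a shortest walk to
  -- be extracted from a given one.
  walk? : ∀ k u v → Dec (Walk G k u v)
  walk? zero    u v = map′ (λ { refl → nil }) (λ { nil → refl }) (u Fin.≟ v)
  walk? (suc k) u v =
    map′ (λ (_ , u~w , p) → cons u~w p) (λ { (cons u~w p) → _ , u~w , p })
         (Fin.any? λ w → (u ~? w) ×-dec walk? k w v)

  -- Step from `x` to an adjacent endpoint of the edge, cross the edge if `y` is attached to the
  -- other endpoint, then step to `y`.
  dominating-edge⇒short-walk : ∀ {u v} → u ~ v → (∀ w → u ~ w ⊎ v ~ w) →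
                               ∀ x y → ∃[ k ] (Walk G k x y × k ≤ 3)
  dominating-edge⇒short-walk u~v cover x y with cover x | cover y
  ... | inj₁ u~x | inj₁ u~y = 2 , cons (~-sym u~x) (cons u~y nil) , s≤s (s≤s z≤n)
  ... | inj₁ u~x | inj₂ v~y = 3 , cons (~-sym u~x) (cons u~v (cons v~y nil)) , ≤-refl
  ... | inj₂ v~x | inj₁ u~y = 3 , cons (~-sym v~x) (cons (~-sym u~v) (cons u~y nil)) , ≤-refl
  ... | inj₂ v~x | inj₂ v~y = 2 , cons (~-sym v~x) (cons v~y nil) , s≤s (s≤s z≤n)

  short-walks⇒diameter : ∀ {b} → Fin n → (∀ x y → ∃[ k ] (Walk G k x y × k ≤ b)) →
                         ∃[ D ] (HasDiameter G D × D ≤ b)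
  short-walks⇒diameter {b} o short =
    dist farthest ,
    ((λ x y → dist (x , y) , proj₁ (proj₂ (distance x y)) , dist≤ x y) ,
     (_ , _ , proj₁ (proj₂ (uncurry distance farthest)))) ,
    proj₂ (proj₂ (uncurry distance farthest))
    where
    distance : ∀ x y → ∃[ d ] (HasDistance G x y d × d ≤ b)
    distance x y with k , p , k≤b ← short x y
                 with d , isMin , d≤k ← minimum-exists (λ j → walk? j x y) k p
                 = d , isMin , ≤-trans d≤k k≤b

    dist : Fin n × Fin n → ℕ
    dist = proj₁ ∘ uncurry distance

    pairs : List (Fin n × Fin n)
    pairs = cartesianProduct (allFin n) (allFin n)

    farthest : Fin n × Fin n
    -- A diameter must be attained, so a maximising pair is chosen. The default `(o , o)` is itself
    -- a pair of vertices, hence a legitimate value.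
    farthest = argmax dist (o , o) pairs

    dist≤ : ∀ x y → dist (x , y) ≤ dist farthest
    dist≤ x y = All.lookup (f[xs]≤f[argmax] {f = dist} (o , o) pairs)
                  (∈-cartesianProduct⁺ (∈-allFin x) (∈-allFin y))

theorem11 : ∀ (n : ℕ) (G : Graph n) → NoIsolatedVertices G →
    (∀ d → HasDeg (harmonicPoly G) d → d ≥ n → HasTriangle G × HasGirth G 3)
    × (TriangleFree G → HasDeg (harmonicPoly G) (n ∸ 1) →
    Connected G × (∃[ D ] (HasDiameter G D × D ≤ 3)))
theorem11 n G _ = high-degree , degree-n∸1
  where
  high-degree : ∀ d → HasDeg (harmonicPoly G) d → d ≥ n → HasTriangle G × HasGirth G 3
  high-degree d (≢0 , _) d≥n
    with u , v , u~v , sum≡ ← coeff-harmonicPoly≢0 G d ≢0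
    = triangle , triangle⇒girth3 G triangle
    where
    triangle : HasTriangle G
    -- The degree sum is `suc d`, so `d ≥ n` makes it strictly larger than `n`.
    triangle = large-degree-sum⇒triangle G u~v (≤-trans (s≤s d≥n) (≤-reflexive (sym sum≡)))

  degree-n∸1 : TriangleFree G → HasDeg (harmonicPoly G) (n ∸ 1) →
               Connected G × (∃[ D ] (HasDiameter G D × D ≤ 3))
  degree-n∸1 free (≢0 , _)
    with u , v , u~v , sum≡ ← coeff-harmonicPoly≢0 G (n ∸ 1) ≢0
    = (λ x y → proj₁ (short x y) , proj₁ (proj₂ (short x y))) , short-walks⇒diameter G u short
    where
    short : ∀ x y → ∃[ k ] (Walk G k x y × k ≤ 3)
    short = dominating-edge⇒short-walk G u~v (neighbourhoods-cover G free u~v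
              -- The degree sum is `suc (n ∸ 1)`, which is at least `n` even under truncation.
              (≤-trans (m≤n+m∸n n 1) (≤-reflexive (sym sum≡))))
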